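{- For every integer $d\ge1$, every integer $n\ge d$, and every $a=(a_1,\dots,a_{n-1})\in[0,1]^{n-1}$, $$R_d\le U_{d,n}(a).$$
   Context: Model. An admissible strategy is a sequence $a=(a_i)_{i\ge 0}$ with $a_i\in[0,1]$ and $a_0=\tfrac12$; $\mathcal A$ is the set of admissible strategies. Extend $a$ to a signed sequence $(b_i)_{i\in\mathbb Z}$ by $b_i=a_i$ for $i\ge0$ and $b_i=1-a_{ -i}$ for $i<0$. Two independent Markov chains $(X_t)_{t\ge0},(Y_t)_{t\ge 0}$ on $\mathbb Z$ start at $X_0=Y_0=0$; each moves from $k$ to $k+1$ with probability $b_k$ and to $k-1$ with probability $1-b_k$. For an integer $d\ge1$ the rendezvous time is $\mathcal T_d(a)=\inf\{t\ge0: X_t=Y_t+2d\}$, and $R_d=\inf_{a\in\mathcal A}\mathbb E[\mathcal T_d(a)]$. Truncated chain. Fix $d\ge1$, $n\ge d$ and $a=(a_1,\dots,a_{n-1})\in[0,1]^{n-1}$. Set $a_0=\frac12$, $a_i=0$ for $i\ge n$, and let $(b_i)$ be the corresponding signed sequence. The level-$n$ truncated chain has states $S_{x,y}$ with $-n\le x,y\le n$, $x-y\le 2d$, $x-y$ even; states with $x-y=2d$ are absorbing; from any other state $S_{x,y}$ the two coordinates move independently, $x\mapsto x+1$ with probability $b_x$ and $x\mapsto x-1$ with probability $1-b_x$, and $y\mapsto y+1$ with probability $b_y$ and $y\mapsto y-1$ with probability $1-b_y$. $U_{d,n}(a)\in[0,\infty]$ is the expected hitting time of the absorbing set starting from $S_{0,0}$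 ($\infty$ if not finite). -}

module Defs where

open import Data.Bool.Base using (if_then_else_)
open import Data.Fin.Base using (Fin; fromℕ<)
open import Data.Integer.Base as ℤ using (ℤ; +_; -[1+_])
import Data.Integer.Divisibility as ℤ
import Data.Integer.Properties as ℤ
open import Data.List.Base as List
  using (List; []; _∷_; concatMap; mapMaybe; cartesianProductWith)
open import Data.Maybe.Base as Maybe using (Maybe; just; nothing)
open import Data.Nat.Base as ℕ using (ℕ; zero; suc; _∸_)
import Data.Nat.Divisibility as ℕ
import Data.Nat.Properties as ℕ
open import Data.Product.Base using (∃; ∃-syntax; _×_; _,_; proj₁; proj₂)
open import Data.Rational.Base as ℚ using (ℚ; 0ℚ; 1ℚ)
import Data.Rational.Properties as ℚ
open import Data.Rational.Solver using (module +-*-Solver)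
open import Data.Vec.Base as Vec using (Vec; []; _∷_)
open import Relation.Binary.PropositionalEquality using (_≡_; refl; cong; cong₂)
open import Relation.Nullary.Decidable using (yes; no; _×-dec_; does)
open import Relation.Unary using (Decidable)

------------------------------------------------------------------------
-- Real numbers: Cauchy sequences of rationals, compared up to _≃_

IsCauchy : (ℕ → ℚ) → Set
IsCauchy u = ∀ ε → 0ℚ ℚ.< ε →
  ∃[ N ] (∀ m n → N ℕ.≤ m → N ℕ.≤ n → ℚ.∣ u m ℚ.- u n ∣ ℚ.≤ ε)

record ℝ : Set where
  constructor mkℝ
  field
    seq    : ℕ → ℚ
    cauchy : IsCauchy seq

open ℝ public

infix 4 _≤_ _≃_

_≤_ : ℝ → ℝ → Set
x ≤ y = ∀ ε → 0ℚ ℚ.< ε → ∃[ N ] (∀ n → N ℕ.≤ n → seq x n ℚ.≤ seq y n ℚ.+ ε)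

_≃_ : ℝ → ℝ → Set
x ≃ y = (x ≤ y) × (y ≤ x)

fromℚ : ℚ → ℝ
fromℚ q = mkℝ (λ _ → q) λ ε 0<ε → 0 , λ _ _ _ _ → begin
  ℚ.∣ q ℚ.- q ∣  ≡⟨ cong ℚ.∣_∣ (ℚ.+-inverseʳ q) ⟩
  0ℚ             ≤⟨ ℚ.<⇒≤ 0<ε ⟩
  ε              ∎
  where open ℚ.≤-Reasoning

fromℕ : ℕ → ℝ
fromℕ k = fromℚ (+ k ℚ./ 1)

0ℝ 1ℝ ½ℝ : ℝ
0ℝ = fromℚ 0ℚ
1ℝ = fromℚ 1ℚ
½ℝ = fromℚ ℚ.½

private
  half-pos : ∀ {ε} → 0ℚ ℚ.< ε → 0ℚ ℚ.< ℚ.½ ℚ.* ε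
  half-pos 0<ε = ℚ.*-monoʳ-<-pos ℚ.½ 0<ε

  half+half : ∀ ε → ℚ.½ ℚ.* ε ℚ.+ ℚ.½ ℚ.* ε ≡ ε
  half+half = solve 1 (λ e → con ℚ.½ :* e :+ con ℚ.½ :* e := e) refl
    where open +-*-Solver

  eventuallyBounded : ∀ x → ∃[ B ] ∃[ N ] (0ℚ ℚ.< B ×
                      (∀ n → N ℕ.≤ n → ℚ.∣ seq x n ∣ ℚ.≤ B))
  eventuallyBounded x with cauchy x 1ℚ (ℚ.positive⁻¹ 1ℚ)
  ... | N , close = 1ℚ ℚ.+ ℚ.∣ seq x N ∣ , N
      , ℚ.+-mono-<-≤ (ℚ.positive⁻¹ 1ℚ) (ℚ.0≤∣p∣ (seq x N))
      , λ n N≤n → begin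
        ℚ.∣ seq x n ∣
          ≡⟨ cong ℚ.∣_∣ (split (seq x n) (seq x N)) ⟩
        ℚ.∣ (seq x n ℚ.- seq x N) ℚ.+ seq x N ∣
          ≤⟨ ℚ.∣p+q∣≤∣p∣+∣q∣ (seq x n ℚ.- seq x N) (seq x N) ⟩
        ℚ.∣ seq x n ℚ.- seq x N ∣ ℚ.+ ℚ.∣ seq x N ∣
          ≤⟨ ℚ.+-monoˡ-≤ ℚ.∣ seq x N ∣ (close n N N≤n ℕ.≤-refl) ⟩
        1ℚ ℚ.+ ℚ.∣ seq x N ∣ ∎
    where
    open ℚ.≤-Reasoning
    split : ∀ p q → p ≡ (p ℚ.- q) ℚ.+ q
    split = solve 2 (λ p q → p := (p :- q) :+ q) refl
      where open +-*-Solver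

  quotient : ∀ C ε → 0ℚ ℚ.< C → 0ℚ ℚ.< ε → ∃[ δ ] (0ℚ ℚ.< δ × C ℚ.* δ ≡ ε)
  quotient C ε 0<C 0<ε = ℚ.1/ C ℚ.* ε
    , ℚ.positive⁻¹ _ {{ℚ.pos*pos⇒pos (ℚ.1/ C) {{ℚ.1/pos⇒pos C}} ε {{ℚ.positive 0<ε}}}}
    , (begin-equality
        C ℚ.* (ℚ.1/ C ℚ.* ε)  ≡⟨ ℚ.*-assoc C (ℚ.1/ C) ε ⟨
        (C ℚ.* ℚ.1/ C) ℚ.* ε  ≡⟨ cong (ℚ._* ε) (ℚ.*-inverseʳ C) ⟩
        1ℚ ℚ.* ε              ≡⟨ ℚ.*-identityˡ ε ⟩
        ε                     ∎)
    where
    open ℚ.≤-Reasoning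
    instance
      C-positive : ℚ.Positive C
      C-positive = ℚ.positive 0<C
      C-nonZero : ℚ.NonZero C
      C-nonZero = ℚ.pos⇒nonZero C

infixl 6 _+_ _-_
infixl 7 _*_

_+_ : ℝ → ℝ → ℝ
x + y = mkℝ (λ n → seq x n ℚ.+ seq y n) λ ε 0<ε →
  let Nx , closeX = cauchy x (ℚ.½ ℚ.* ε) (half-pos 0<ε)
      Ny , closeY = cauchy y (ℚ.½ ℚ.* ε) (half-pos 0<ε)
  in Nx ℕ.⊔ Ny , λ m n N≤m N≤n → begin
    ℚ.∣ (seq x m ℚ.+ seq y m) ℚ.- (seq x n ℚ.+ seq y n) ∣
      ≡⟨ cong ℚ.∣_∣ (regroup (seq x m) (seq y m) (seq x n) (seq y n)) ⟩
    ℚ.∣ (seq x m ℚ.- seq x n) ℚ.+ (seq y m ℚ.- seq y n) ∣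
      ≤⟨ ℚ.∣p+q∣≤∣p∣+∣q∣ (seq x m ℚ.- seq x n) (seq y m ℚ.- seq y n) ⟩
    ℚ.∣ seq x m ℚ.- seq x n ∣ ℚ.+ ℚ.∣ seq y m ℚ.- seq y n ∣
      ≤⟨ ℚ.+-mono-≤
           (closeX m n (ℕ.m⊔n≤o⇒m≤o Nx Ny N≤m) (ℕ.m⊔n≤o⇒m≤o Nx Ny N≤n))
           (closeY m n (ℕ.m⊔n≤o⇒n≤o Nx Ny N≤m) (ℕ.m⊔n≤o⇒n≤o Nx Ny N≤n)) ⟩
    ℚ.½ ℚ.* ε ℚ.+ ℚ.½ ℚ.* ε
      ≡⟨ half+half ε ⟩
    ε ∎
  where
  open ℚ.≤-Reasoning
  regroup : ∀ p q r s → (p ℚ.+ q) ℚ.- (r ℚ.+ s) ≡ (p ℚ.- r) ℚ.+ (q ℚ.- s)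
  regroup = solve 4 (λ p q r s → (p :+ q) :- (r :+ s) := (p :- r) :+ (q :- s)) refl
    where open +-*-Solver

-_ : ℝ → ℝ
- x = mkℝ (λ n → ℚ.- seq x n) λ ε 0<ε →
  let N , close = cauchy x ε 0<ε
  in N , λ m n N≤m N≤n → begin
    ℚ.∣ (ℚ.- seq x m) ℚ.- (ℚ.- seq x n) ∣
      ≡⟨ cong ℚ.∣_∣ (swap (seq x m) (seq x n)) ⟩
    ℚ.∣ seq x n ℚ.- seq x m ∣
      ≤⟨ close n m N≤n N≤m ⟩
    ε ∎
  where
  open ℚ.≤-Reasoning
  swap : ∀ p q → (ℚ.- p) ℚ.- (ℚ.- q) ≡ q ℚ.- p
  swap = solve 2 (λ p q → (:- p) :- (:- q) := q :- p) refl
    where open +-*-Solver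

_-_ : ℝ → ℝ → ℝ
x - y = x + (- y)

_*_ : ℝ → ℝ → ℝ
x * y = mkℝ (λ n → seq x n ℚ.* seq y n) isCauchy
  where
  open ℚ.≤-Reasoning
  regroup : ∀ p q r s → p ℚ.* q ℚ.- r ℚ.* s ≡ p ℚ.* (q ℚ.- s) ℚ.+ s ℚ.* (p ℚ.- r)
  regroup = solve 4 (λ p q r s → p :* q :- r :* s := p :* (q :- s) :+ s :* (p :- r)) refl
    where open +-*-Solver

  *-mono : ∀ {p q r s} → 0ℚ ℚ.≤ p → 0ℚ ℚ.≤ s → p ℚ.≤ q → r ℚ.≤ s → p ℚ.* r ℚ.≤ q ℚ.* s
  *-mono {p} {q} {r} {s} 0≤p 0≤s p≤q r≤s = ℚ.≤-trans
    (ℚ.*-monoˡ-≤-nonNeg p {{ℚ.nonNegative 0≤p}} r≤s)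
    (ℚ.*-monoʳ-≤-nonNeg s {{ℚ.nonNegative 0≤s}} p≤q)

  isCauchy : IsCauchy (λ n → seq x n ℚ.* seq y n)
  isCauchy ε 0<ε =
    let Bx , Mx , 0<Bx , boundX = eventuallyBounded x
        By , My , 0<By , boundY = eventuallyBounded y
        δ , 0<δ , Cδ≡ε = quotient (Bx ℚ.+ By) ε (ℚ.+-mono-< 0<Bx 0<By) 0<ε
        Nx , closeX = cauchy x δ 0<δ
        Ny , closeY = cauchy y δ 0<δ
    in
    (Mx ℕ.⊔ My) ℕ.⊔ (Nx ℕ.⊔ Ny) , λ m n N≤m N≤n →
      let Mm = ℕ.m⊔n≤o⇒m≤o (Mx ℕ.⊔ My) (Nx ℕ.⊔ Ny) N≤m
          Mn = ℕ.m⊔n≤o⇒m≤o (Mx ℕ.⊔ My) (Nx ℕ.⊔ Ny) N≤n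
          Nm = ℕ.m⊔n≤o⇒n≤o (Mx ℕ.⊔ My) (Nx ℕ.⊔ Ny) N≤m
          Nn = ℕ.m⊔n≤o⇒n≤o (Mx ℕ.⊔ My) (Nx ℕ.⊔ Ny) N≤n
      in begin
      ℚ.∣ seq x m ℚ.* seq y m ℚ.- seq x n ℚ.* seq y n ∣
        ≡⟨ cong ℚ.∣_∣ (regroup (seq x m) (seq y m) (seq x n) (seq y n)) ⟩
      ℚ.∣ seq x m ℚ.* (seq y m ℚ.- seq y n) ℚ.+ seq y n ℚ.* (seq x m ℚ.- seq x n) ∣
        ≤⟨ ℚ.∣p+q∣≤∣p∣+∣q∣ (seq x m ℚ.* (seq y m ℚ.- seq y n))
                            (seq y n ℚ.* (seq x m ℚ.- seq x n)) ⟩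
      ℚ.∣ seq x m ℚ.* (seq y m ℚ.- seq y n) ∣ ℚ.+ ℚ.∣ seq y n ℚ.* (seq x m ℚ.- seq x n) ∣
        ≡⟨ cong₂ ℚ._+_ (ℚ.∣p*q∣≡∣p∣*∣q∣ (seq x m) (seq y m ℚ.- seq y n))
                       (ℚ.∣p*q∣≡∣p∣*∣q∣ (seq y n) (seq x m ℚ.- seq x n)) ⟩
      ℚ.∣ seq x m ∣ ℚ.* ℚ.∣ seq y m ℚ.- seq y n ∣ ℚ.+ ℚ.∣ seq y n ∣ ℚ.* ℚ.∣ seq x m ℚ.- seq x n ∣
        ≤⟨ ℚ.+-mono-≤
             (*-mono (ℚ.0≤∣p∣ (seq x m)) (ℚ.<⇒≤ 0<δ)
               (boundX m (ℕ.m⊔n≤o⇒m≤o Mx My Mm))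
               (closeY m n (ℕ.m⊔n≤o⇒n≤o Nx Ny Nm) (ℕ.m⊔n≤o⇒n≤o Nx Ny Nn)))
             (*-mono (ℚ.0≤∣p∣ (seq y n)) (ℚ.<⇒≤ 0<δ)
               (boundY n (ℕ.m⊔n≤o⇒n≤o Mx My Mn))
               (closeX m n (ℕ.m⊔n≤o⇒m≤o Nx Ny Nm) (ℕ.m⊔n≤o⇒m≤o Nx Ny Nn))) ⟩
      Bx ℚ.* δ ℚ.+ By ℚ.* δ
        ≡⟨ ℚ.*-distribʳ-+ δ Bx By ⟨
      (Bx ℚ.+ By) ℚ.* δ
        ≡⟨ Cδ≡ε ⟩
      ε ∎

_∈[0,1] : ℝ → Set
x ∈[0,1] = (0ℝ ≤ x) × (x ≤ 1ℝ)

------------------------------------------------------------------------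
-- Extended reals [-∞,∞] as open upper cuts of ℚ: x is represented by
-- { q ∣ x < q }, so ∞ is the empty cut and -∞ is all of ℚ. Unlike in ℝ,
-- arbitrary infima and suprema exist constructively.

record ℝ∞ : Set₁ where
  field
    Above   : ℚ → Set
    upward  : ∀ {p q} → p ℚ.< q → Above p → Above q
    rounded : ∀ {q} → Above q → ∃[ p ] (p ℚ.< q × Above p)

open ℝ∞ public

infix 4 _≤∞_

_≤∞_ : ℝ∞ → ℝ∞ → Set
x ≤∞ y = ∀ q → Above y q → Above x q

inf : {I : Set} → (I → ℝ∞) → ℝ∞
inf x = record
  { Above   = λ q → ∃[ i ] Above (x i) q
  ; upward  = λ { p<q (i , h) → i , upward (x i) p<q h }
  ; rounded = λ { (i , h) → let p , p<q , h′ = rounded (x i) h in p , p<q , i , h′ }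
  }

-- Bounding every term by some p < q, rather than by q, is what makes the
-- cut of the supremum open.
sup : (ℕ → ℝ) → ℝ∞
sup x = record
  { Above   = λ q → ∃[ p ] (p ℚ.< q × (∀ N → x N ≤ fromℚ p))
  ; upward  = λ { p<q (r , r<p , h) → r , ℚ.<-trans r<p p<q , h }
  ; rounded = λ { (r , r<q , h) → let s , r<s , s<q = ℚ.<-dense r<q in
                                  s , s<q , r , r<s , h }
  }

------------------------------------------------------------------------
-- Finitely supported distributions and Markov chains

-- (p , s) ∈ μ is an atom of mass p at s; atoms at the same point add up.
Dist : Set → Set
Dist A = List (ℝ × A)

𝔼[_] : ∀ {A} → (A → ℕ) → Dist A → ℝ
𝔼[ f ] = List.foldr (λ { (p , s) acc → p * fromℕ (f s) + acc }) 0ℝ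

_⊗_ : ∀ {A B} → Dist A → Dist B → Dist (A × B)
_⊗_ = cartesianProductWith λ { (p , s) (q , t) → p * q , (s , t) }

-- The law of (Z₀, …, Z_N) for the Markov chain Z started at s: a path has
-- mass the product of its transition probabilities.
trajectory : ∀ {S} → (S → Dist S) → S → ∀ N → Dist (Vec S (suc N))
trajectory step s zero    = (1ℝ , s ∷ []) ∷ []
trajectory step s (suc N) = concatMap
  (λ { (p , s′) → List.map (λ { (q , path) → p * q , s ∷ path })
                           (trajectory step s′ N) })
  (step s)

-- On a path (z₀, …, z_N) this is min(T, N) with T = inf { t ∣ P z_t }.
hit∧ : ∀ {S : Set} {P : S → Set} → Decidable P → ∀ {N} → Vec S (suc N) → ℕ
hit∧ P? {zero}  _          = 0
hit∧ P? {suc N} (z ∷ path) = if does (P? z) then 0 else suc (hit∧ P? path)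

-- An expectation 𝔼[T] ∈ [0,∞] of an ℕ ∪ {∞}-valued stopping time is the limit
-- of the nondecreasing sequence 𝔼[min(T,N)], where min(T,N) is a function
-- of the first N steps.

------------------------------------------------------------------------
-- Strategies and the rendezvous time

record Strategy : Set where
  field
    prob   : ℕ → ℝ
    bounds : ∀ i → prob i ∈[0,1]
    start  : prob 0 ≃ ½ℝ

open Strategy public

signed : (ℕ → ℝ) → ℤ → ℝ
signed a (+ i)      = a i
signed a (-[1+ i ]) = 1ℝ - a (suc i)

walk : (ℤ → ℝ) → ℤ → Dist ℤ
walk b k = (b k , k ℤ.+ + 1) ∷ (1ℝ - b k , k ℤ.- + 1) ∷ []

Met : ℕ → ℤ × ℤ → Set
Met d (x , y) = x ≡ y ℤ.+ + (2 ℕ.* d)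

met? : ∀ d → Decidable (Met d)
met? d (x , y) = x ℤ.≟ y ℤ.+ + (2 ℕ.* d)

𝔼𝒯 : ℕ → Strategy → ℝ∞
𝔼𝒯 d a = sup λ N →
  𝔼[ (λ { (xs , ys) → hit∧ (met? d) (Vec.zip xs ys) }) ] (path N ⊗ path N)
  where
  path : ∀ N → Dist (Vec ℤ (suc N))
  path = trajectory (walk (signed (prob a))) (+ 0)

R : ℕ → ℝ∞
R d = inf (𝔼𝒯 d)

------------------------------------------------------------------------
-- The truncated chain

-- The vector (a₁, …, a_{n-1}) is indexed from 0: a i stands for a_{i+1}.
extend : ∀ n → (Fin (n ∸ 1) → ℝ) → ℕ → ℝ
extend n a zero    = ½ℝ
extend n a (suc i) with i ℕ.<? n ∸ 1
... | yes i<n-1 = a (fromℕ< i<n-1)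
... | no  _     = 0ℝ

IsState : ℕ → ℕ → ℤ × ℤ → Set
IsState d n (x , y) =
  ((ℤ.- + n ℤ.≤ x) × (x ℤ.≤ + n)) ×
  ((ℤ.- + n ℤ.≤ y) × (y ℤ.≤ + n)) ×
  (x ℤ.- y ℤ.≤ + (2 ℕ.* d)) ×
  (+ 2 ℤ.∣ x ℤ.- y)

isState? : ∀ d n → Decidable (IsState d n)
isState? d n (x , y) =
  ((ℤ.- + n ℤ.≤? x) ×-dec (x ℤ.≤? + n)) ×-dec
  ((ℤ.- + n ℤ.≤? y) ×-dec (y ℤ.≤? + n)) ×-dec
  (x ℤ.- y ℤ.≤? + (2 ℕ.* d)) ×-dec
  (2 ℕ.∣? ℤ.∣ x ℤ.- y ∣)

State : ℕ → ℕ → Set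
State d n = ∃ (IsState d n)

toState : ∀ d n → ℤ × ℤ → Maybe (State d n)
toState d n z with isState? d n z
... | yes h = just (z , h)
... | no  _ = nothing

S₀₀ : ∀ d n → State d n
S₀₀ d n = (+ 0 , + 0)
  , (ℤ.neg-mono-≤ 0≤n , 0≤n) , (ℤ.neg-mono-≤ 0≤n , 0≤n)
  , ℤ.+≤+ ℕ.z≤n , (2 ℕ.∣0)
  where
  0≤n : + 0 ℤ.≤ + n
  0≤n = ℤ.+≤+ ℕ.z≤n

Absorbing : ∀ d n → State d n → Set
Absorbing d n ((x , y) , _) = x ℤ.- y ≡ + (2 ℕ.* d)

absorbing? : ∀ d n → Decidable (Absorbing d n)
absorbing? d n ((x , y) , _) = x ℤ.- y ℤ.≟ + (2 ℕ.* d)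

-- A move out of the state space leaves [-n,n] in some coordinate; it is
-- discarded, and loses no mass because such a move has probability 0
-- (b n = 0 and b (- n) = 1 for n ≥ 1).
truncatedStep : ∀ d n → (Fin (n ∸ 1) → ℝ) → State d n → Dist (State d n)
truncatedStep d n a s@((x , y) , _) =
  if does (absorbing? d n s)
  then (1ℝ , s) ∷ []
  else mapMaybe (λ { (p , z) → Maybe.map (p ,_) (toState d n z) })
                (walk b x ⊗ walk b y)
  where
  b : ℤ → ℝ
  b = signed (extend n a)

U : ∀ d n → (Fin (n ∸ 1) → ℝ) → ℝ∞
U d n a = sup λ N →
  𝔼[ hit∧ (absorbing? d n) ] (trajectory (truncatedStep d n a) (S₀₀ d n) N)

{-# OPTIONS --safe #-}
-- The vector a, padded by 1/2 in front and by zeros behind, is an admissible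
-- strategy. Under it neither walker ever leaves [-n,n], and x - y, being
-- even, cannot jump over 2d; so up to the meeting time the two free walks are
-- exactly the truncated chain, and E[min(T,N)] is the same number for both
-- chains, for every N. Reals being sequences of rationals with pointwise
-- operations, the two expectations even agree at every index k.
module Submission where

open import Defs
open import Data.Bool.Base using (if_then_else_)
open import Data.Fin.Base using (Fin; fromℕ<)
open import Data.Integer.Base as ℤ using (ℤ; +_; -[1+_])
import Data.Integer.Divisibility as ℤ
import Data.Integer.Divisibility.Signed as Signed
import Data.Integer.Properties as ℤ
import Data.Integer.Tactic.RingSolver as ℤ-Ring
open import Data.List.Base using ([]; _∷_; _++_; map; foldr; concatMap)
open import Data.Maybe.Base as Maybe using (Maybe; just; nothing; maybe′)
open import Data.Nat.Base as ℕ using (ℕ; zero; suc; _∸_)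
import Data.Nat.Divisibility as ℕ
import Data.Nat.Properties as ℕ
open import Data.Product.Base using (_×_; _,_; proj₁; proj₂; uncurry)
open import Data.Rational.Base as ℚ using (ℚ; 0ℚ; 1ℚ)
import Data.Rational.Properties as ℚ
open import Data.Rational.Solver using (module +-*-Solver)
import Data.Rational.Unnormalised.Base as ℚᵘ
import Data.Rational.Unnormalised.Properties as ℚᵘ
open import Data.Sum.Base using (_⊎_; inj₁; inj₂)
open import Data.Vec.Base as Vec using (Vec; _∷_)
open import Function.Base using (_∘_; id; case_of_)
open import Relation.Binary.PropositionalEquality
  using (_≡_; _≢_; refl; sym; trans; cong; cong₂; subst; module ≡-Reasoning)
open import Relation.Nullary.Decidable using (Dec; does; yes; no; dec-true; dec-false)
open import Relation.Nullary.Negation using (¬_; contradiction)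
open import Relation.Unary using (Decidable)

private
  variable
    A B S : Set

-- `_/ 1` reduces by a gcd and does not compute for a variable `m`; among unnormalised rationals
-- only integer arithmetic remains.
fromℕ-suc : ∀ m → + suc m ℚ./ 1 ≡ 1ℚ ℚ.+ + m ℚ./ 1
fromℕ-suc m = ℚ.toℚᵘ-injective (begin
  ℚ.toℚᵘ (+ suc m ℚ./ 1)              ≈⟨ ℚ.toℚᵘ-fromℚᵘ (ℚᵘ.mkℚᵘ (+ suc m) 0) ⟩
  ℚᵘ.mkℚᵘ (+ suc m) 0                 ≈⟨ ℚᵘ.*≡* (cong (λ i → (+ 1 ℤ.+ i) ℤ.* + 1)
                                                 (sym (ℤ.*-identityʳ (+ m)))) ⟩
  ℚᵘ.1ℚᵘ ℚᵘ.+ ℚᵘ.mkℚᵘ (+ m) 0         ≈⟨ ℚᵘ.+-congʳ ℚᵘ.1ℚᵘ (ℚ.toℚᵘ-fromℚᵘ (ℚᵘ.mkℚᵘ (+ m) 0)) ⟨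
  ℚᵘ.1ℚᵘ ℚᵘ.+ ℚ.toℚᵘ (+ m ℚ./ 1)      ≈⟨ ℚ.toℚᵘ-homo-+ 1ℚ (+ m ℚ./ 1) ⟨
  ℚ.toℚᵘ (1ℚ ℚ.+ + m ℚ./ 1)           ∎)
  where open ℚᵘ.≃-Reasoning

independent : (A → Dist A) → (B → Dist B) → A × B → Dist (A × B)
independent α β (x , y) = α x ⊗ β y

-- Finite expectations at one index of the Cauchy sequences

module Expectation (k : ℕ) where

  open ≡-Reasoning

  E : (A → ℚ) → Dist A → ℚ
  E f []            = 0ℚ
  E f ((p , s) ∷ μ) = seq p k ℚ.* f s ℚ.+ E f μ

  -- At a single index a mass may be negative or exceed 1, but `1ℝ - p` is computed pointwise, so
  -- total mass one can be an exact equality.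
  Normalised : Dist A → Set
  Normalised μ = E (λ _ → 1ℚ) μ ≡ 1ℚ

  -- 𝔼[ f ] is foldr c 0ℝ for a step function c that is left to unification:
  -- stating this for 𝔼[ f ] itself would make Agda compare Cauchy proofs.
  seq-foldr : (c : ℝ × A → ℝ → ℝ) (f : A → ℚ) →
    (∀ p s r → seq (c (p , s) r) k ≡ seq p k ℚ.* f s ℚ.+ seq r k) →
    ∀ μ → seq (foldr c 0ℝ μ) k ≡ E f μ
  seq-foldr c f eq []            = refl
  seq-foldr c f eq ((p , s) ∷ μ) =
    trans (eq p s (foldr c 0ℝ μ)) (cong (seq p k ℚ.* f s ℚ.+_) (seq-foldr c f eq μ))

  E-cong : {f g : A → ℚ} → (∀ s → f s ≡ g s) → ∀ μ → E f μ ≡ E g μ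
  E-cong f≗g []            = refl
  E-cong f≗g ((p , s) ∷ μ) = cong₂ (λ u v → seq p k ℚ.* u ℚ.+ v) (f≗g s) (E-cong f≗g μ)

  E-0 : (μ : Dist A) → E (λ _ → 0ℚ) μ ≡ 0ℚ
  E-0 []            = refl
  E-0 ((p , s) ∷ μ) = cong₂ ℚ._+_ (ℚ.*-zeroʳ (seq p k)) (E-0 μ)

  E-+ : (f g : A → ℚ) (μ : Dist A) → E (λ s → f s ℚ.+ g s) μ ≡ E f μ ℚ.+ E g μ
  E-+ f g []            = refl
  E-+ f g ((p , s) ∷ μ) = begin
    seq p k ℚ.* (f s ℚ.+ g s) ℚ.+ E (λ s → f s ℚ.+ g s) μ
      ≡⟨ cong (seq p k ℚ.* (f s ℚ.+ g s) ℚ.+_) (E-+ f g μ) ⟩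
    seq p k ℚ.* (f s ℚ.+ g s) ℚ.+ (E f μ ℚ.+ E g μ)
      ≡⟨ solve 5 (λ p u v x y → p :* (u :+ v) :+ (x :+ y) := (p :* u :+ x) :+ (p :* v :+ y))
           refl (seq p k) (f s) (g s) (E f μ) (E g μ) ⟩
    (seq p k ℚ.* f s ℚ.+ E f μ) ℚ.+ (seq p k ℚ.* g s ℚ.+ E g μ) ∎
    where open +-*-Solver

  E-*ˡ : ∀ c (f : A → ℚ) μ → E (λ s → c ℚ.* f s) μ ≡ c ℚ.* E f μ
  E-*ˡ c f []            = sym (ℚ.*-zeroʳ c)
  E-*ˡ c f ((p , s) ∷ μ) = begin
    seq p k ℚ.* (c ℚ.* f s) ℚ.+ E (λ s → c ℚ.* f s) μ
      ≡⟨ cong (seq p k ℚ.* (c ℚ.* f s) ℚ.+_) (E-*ˡ c f μ) ⟩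
    seq p k ℚ.* (c ℚ.* f s) ℚ.+ c ℚ.* E f μ
      ≡⟨ solve 4 (λ p c u x → p :* (c :* u) :+ c :* x := c :* (p :* u :+ x))
           refl (seq p k) c (f s) (E f μ) ⟩
    c ℚ.* (seq p k ℚ.* f s ℚ.+ E f μ) ∎
    where open +-*-Solver

  E-1+ : (f : A → ℚ) (μ : Dist A) → Normalised μ → E (λ s → 1ℚ ℚ.+ f s) μ ≡ 1ℚ ℚ.+ E f μ
  E-1+ f μ μ-norm = trans (E-+ (λ _ → 1ℚ) f μ) (cong (ℚ._+ E f μ) μ-norm)

  -- Finite Fubini, needed to bring the first step of one walk in front of the remaining path of the
  -- other.
  E-swap : (f : A → B → ℚ) (μ : Dist A) (ν : Dist B) →
           E (λ s → E (f s) ν) μ ≡ E (λ t → E (λ s → f s t) μ) ν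
  E-swap f []            ν = sym (E-0 ν)
  E-swap f ((p , s) ∷ μ) ν = begin
    seq p k ℚ.* E (f s) ν ℚ.+ E (λ s → E (f s) ν) μ
      ≡⟨ cong₂ ℚ._+_ (sym (E-*ˡ (seq p k) (f s) ν)) (E-swap f μ ν) ⟩
    E (λ t → seq p k ℚ.* f s t) ν ℚ.+ E (λ t → E (λ s → f s t) μ) ν
      ≡⟨ E-+ (λ t → seq p k ℚ.* f s t) (λ t → E (λ s → f s t) μ) ν ⟨
    E (λ t → seq p k ℚ.* f s t ℚ.+ E (λ s → f s t) μ) ν ∎

  E-++ : (f : A → ℚ) (μ ν : Dist A) → E f (μ ++ ν) ≡ E f μ ℚ.+ E f ν
  E-++ f []            ν = sym (ℚ.+-identityˡ (E f ν))
  E-++ f ((p , s) ∷ μ) ν = trans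
    (cong (seq p k ℚ.* f s ℚ.+_) (E-++ f μ ν))
    (sym (ℚ.+-assoc (seq p k ℚ.* f s) (E f μ) (E f ν)))

  -- `φ` is known only through its effect on a weighted value, so that it can be unified with the
  -- anonymous functions inside `_⊗_` and `trajectory`.
  E-map : ∀ c {φ : ℝ × A → ℝ × B} {f : B → ℚ} (g : A → ℚ) →
          (∀ p s → uncurry (λ q t → seq q k ℚ.* f t) (φ (p , s)) ≡ c ℚ.* seq p k ℚ.* g s) →
          ∀ μ → E f (map φ μ) ≡ c ℚ.* E g μ
  E-map c g eq [] = sym (ℚ.*-zeroʳ c)
  E-map c g eq ((p , s) ∷ μ) = trans
    (cong₂ ℚ._+_ (trans (eq p s) (ℚ.*-assoc c (seq p k) (g s))) (E-map c g eq μ))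
    (sym (ℚ.*-distribˡ-+ c (seq p k ℚ.* g s) (E g μ)))

  E-concatMap : ∀ {κ : ℝ × A → Dist B} {f : B → ℚ} {g : A → ℚ} →
                (∀ p s → E f (κ (p , s)) ≡ seq p k ℚ.* g s) →
                ∀ μ → E f (concatMap κ μ) ≡ E g μ
  E-concatMap eq [] = refl
  E-concatMap {κ = κ} {f = f} eq ((p , s) ∷ μ) = trans
    (E-++ f (κ (p , s)) (concatMap κ μ))
    (cong₂ ℚ._+_ (eq p s) (E-concatMap eq μ))

  E-if-yes : ∀ {P : Set} (P? : Dec P) (f : A → ℚ) {μ ν : Dist A} {v} → P →
             E f μ ≡ v → E f (if does P? then μ else ν) ≡ v
  E-if-yes (yes _)  f Px eq = eq
  E-if-yes (no ¬Px) f Px eq = contradiction Px ¬Px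

  E-if-no : ∀ {P : Set} (P? : Dec P) (f : A → ℚ) {μ ν : Dist A} {v} → ¬ P →
            E f ν ≡ v → E f (if does P? then μ else ν) ≡ v
  E-if-no (yes Px) f ¬P eq = contradiction Px ¬P
  E-if-no (no  _)  f ¬P eq = eq

  -- One step of evaluating mapMaybe on an explicit list of atoms.
  E-maybe-∷ : ∀ (f : A → ℚ) (m : Maybe (ℝ × A)) {μ u v} →
              maybe′ (λ (q , s) → seq q k ℚ.* f s) 0ℚ m ≡ u → E f μ ≡ v →
              E f (maybe′ _∷_ id m μ) ≡ u ℚ.+ v
  E-maybe-∷ f (just _) eq eqs = cong₂ ℚ._+_ eq eqs
  E-maybe-∷ f nothing {μ} eq eqs = trans (sym (ℚ.+-identityˡ (E f μ))) (cong₂ ℚ._+_ eq eqs)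

  E-⊗ : (f : A × B → ℚ) (μ : Dist A) (ν : Dist B) →
        E f (μ ⊗ ν) ≡ E (λ s → E (λ t → f (s , t)) ν) μ
  E-⊗ f []            ν = refl
  E-⊗ f ((p , s) ∷ μ) ν = trans (E-++ f (map _ ν) (μ ⊗ ν))
    (cong₂ ℚ._+_ (E-map (seq p k) (λ t → f (s , t)) (λ _ _ → refl) ν) (E-⊗ f μ ν))

  ⊗-normalised : (μ : Dist A) (ν : Dist B) → Normalised μ → Normalised ν → Normalised (μ ⊗ ν)
  ⊗-normalised μ ν μ-norm ν-norm =
    trans (E-⊗ (λ _ → 1ℚ) μ ν) (trans (E-cong (λ _ → ν-norm) μ) μ-norm)

  E-trajectory : (step : S → Dist S) (s : S) (N : ℕ) (f : Vec S (2 ℕ.+ N) → ℚ) →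
    E f (trajectory step s (suc N)) ≡
    E (λ s′ → E (λ path → f (s ∷ path)) (trajectory step s′ N)) (step s)
  E-trajectory step s N f =
    E-concatMap
      (λ p s′ → E-map (seq p k) (λ path → f (s ∷ path)) (λ _ _ → refl) (trajectory step s′ N))
      (step s)

  trajectory-normalised : (step : S → Dist S) → (∀ s → Normalised (step s)) →
                          ∀ s N → Normalised (trajectory step s N)
  trajectory-normalised step norm s zero    = refl
  trajectory-normalised step norm s (suc N) = begin
    E (λ _ → 1ℚ) (trajectory step s (suc N))
      ≡⟨ E-trajectory step s N (λ _ → 1ℚ) ⟩
    E (λ s′ → E (λ _ → 1ℚ) (trajectory step s′ N)) (step s)
      ≡⟨ E-cong (λ s′ → trajectory-normalised step norm s′ N) (step s) ⟩
    E (λ _ → 1ℚ) (step s)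
      ≡⟨ norm s ⟩
    1ℚ ∎

  -- Induction on `N`: expose the first step of each walk, move that of the second past the rest of
  -- the first by `E-swap`, and recombine the two remaining paths.
  E-trajectory-⊗ : (α : A → Dist A) (β : B → Dist B) (x : A) (y : B) (N : ℕ)
    (f : Vec (A × B) (suc N) → ℚ) →
    E (λ (xs , ys) → f (Vec.zip xs ys)) (trajectory α x N ⊗ trajectory β y N) ≡
    E f (trajectory (independent α β) (x , y) N)
  E-trajectory-⊗ α β x y zero    f = refl
  E-trajectory-⊗ α β x y (suc N) f = begin
    E (λ (xs , ys) → f (Vec.zip xs ys)) (trajectory α x (suc N) ⊗ trajectory β y (suc N))
      ≡⟨ E-⊗ _ (trajectory α x (suc N)) (trajectory β y (suc N)) ⟩
    E (λ xs → E (λ ys → f (Vec.zip xs ys)) (trajectory β y (suc N))) (trajectory α x (suc N))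
      ≡⟨ E-trajectory α x N _ ⟩
    E (λ x′ → E (λ xs → E (λ ys → f (Vec.zip (x ∷ xs) ys))
                          (trajectory β y (suc N)))
                (trajectory α x′ N))
      (α x)
      ≡⟨ E-cong (λ x′ → E-cong (λ xs → E-trajectory β y N _) (trajectory α x′ N)) (α x) ⟩
    E (λ x′ → E (λ xs → E (λ y′ → E (λ ys → g (Vec.zip xs ys)) (trajectory β y′ N)) (β y))
                (trajectory α x′ N))
      (α x)
      ≡⟨ E-cong (λ x′ → E-swap _ (trajectory α x′ N) (β y)) (α x) ⟩
    E (λ x′ → E (λ y′ → E (λ xs → E (λ ys → g (Vec.zip xs ys)) (trajectory β y′ N))
                          (trajectory α x′ N))
                (β y))
      (α x)
      ≡⟨ E-cong (λ x′ → E-cong (λ y′ →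
           trans (sym (E-⊗ _ (trajectory α x′ N) (trajectory β y′ N)))
                 (E-trajectory-⊗ α β x′ y′ N g)) (β y)) (α x) ⟩
    E (λ x′ → E (λ y′ → E g (trajectory γ (x′ , y′) N)) (β y)) (α x)
      ≡⟨ E-⊗ (λ z → E g (trajectory γ z N)) (α x) (β y) ⟨
    E (λ z → E g (trajectory γ z N)) (γ (x , y))
      ≡⟨ E-trajectory γ (x , y) N f ⟨
    E f (trajectory γ (x , y) (suc N)) ∎
    where
    γ = independent α β
    g = λ path → f ((x , y) ∷ path)

  -- First-step analysis of the capped hitting time

  module _ {P : S → Set} (P? : Decidable P) where

    hitℚ : ∀ {N} → Vec S (suc N) → ℚ
    hitℚ path = + hit∧ P? path ℚ./ 1

    -- Once `P` holds the later motion is irrelevant, so the self-loop of the truncated chain and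
    -- the onward motion of the free one count alike.
    E-hit-yes : ∀ (step : S → Dist S) s N → P s → E hitℚ (trajectory step s N) ≡ 0ℚ
    E-hit-yes step s zero    Ps = refl
    E-hit-yes step s (suc N) Ps = begin
      E hitℚ (trajectory step s (suc N))
        ≡⟨ E-trajectory step s N hitℚ ⟩
      E (λ s′ → E (λ path → hitℚ (s ∷ path)) (trajectory step s′ N)) (step s)
        ≡⟨ E-cong (λ s′ → trans (E-cong hit≡0 (trajectory step s′ N))
                                (E-0 (trajectory step s′ N))) (step s) ⟩
      E (λ _ → 0ℚ) (step s)
        ≡⟨ E-0 (step s) ⟩
      0ℚ ∎
      where
      hit≡0 : (path : Vec S (suc N)) → hitℚ (s ∷ path) ≡ 0ℚ
      hit≡0 path rewrite dec-true (P? s) Ps = refl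

    -- The unit of time spent comes out as exactly 1 because the law of the remaining path has mass
    -- one.
    E-hit-no : ∀ (step : S → Dist S) → (∀ s → Normalised (step s)) → ∀ s N → ¬ P s →
      E hitℚ (trajectory step s (suc N)) ≡
      E (λ s′ → 1ℚ ℚ.+ E hitℚ (trajectory step s′ N)) (step s)
    E-hit-no step norm s N ¬Ps = begin
      E hitℚ (trajectory step s (suc N))
        ≡⟨ E-trajectory step s N hitℚ ⟩
      E (λ s′ → E (λ path → hitℚ (s ∷ path)) (trajectory step s′ N)) (step s)
        ≡⟨ E-cong (λ s′ → trans (E-cong hit-suc (trajectory step s′ N))
             (E-1+ hitℚ (trajectory step s′ N) (trajectory-normalised step norm s′ N))) (step s) ⟩
      E (λ s′ → 1ℚ ℚ.+ E hitℚ (trajectory step s′ N)) (step s) ∎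
      where
      hit-suc : (path : Vec S (suc N)) → hitℚ (s ∷ path) ≡ 1ℚ ℚ.+ hitℚ path
      hit-suc path rewrite dec-false (P? s) ¬Ps = fromℕ-suc (hit∧ P? path)

  walk-normalised : ∀ b x → Normalised (walk b x)
  walk-normalised b x =
    solve 1 (λ p → p :* con 1ℚ :+ ((con 1ℚ :+ (:- p)) :* con 1ℚ :+ con 0ℚ) := con 1ℚ)
      refl (seq (b x) k)
    where open +-*-Solver

-- The padded strategy and the geometry of the state space

extend-boundary : ∀ {n} → 1 ℕ.≤ n → ∀ a → extend n a n ≡ 0ℝ
extend-boundary {suc m} _ a with m ℕ.<? m
... | yes m<m = contradiction m<m (ℕ.n≮n m)
... | no  _   = refl

extend-strategy : ∀ n (a : Fin (n ∸ 1) → ℝ) → (∀ i → a i ∈[0,1]) → Strategy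
extend-strategy n a a∈[0,1] = record
  { prob   = extend n a
  ; bounds = extend∈[0,1]
  ; start  = constant-≤ ℚ.≤-refl , constant-≤ ℚ.≤-refl
  }
  where
  constant-≤ : ∀ {p q} → p ℚ.≤ q → fromℚ p ≤ fromℚ q
  constant-≤ {p} {q} p≤q ε 0<ε = 0 , λ _ _ → begin
    p          ≤⟨ p≤q ⟩
    q          ≡⟨ ℚ.+-identityʳ q ⟨
    q ℚ.+ 0ℚ   ≤⟨ ℚ.+-monoʳ-≤ q (ℚ.<⇒≤ 0<ε) ⟩
    q ℚ.+ ε    ∎
    where open ℚ.≤-Reasoning

  extend∈[0,1] : ∀ i → extend n a i ∈[0,1]
  extend∈[0,1] zero    = constant-≤ (ℚ.nonNegative⁻¹ ℚ.½) , constant-≤ {ℚ.½} {1ℚ} (ℚ.≤ᵇ⇒≤ _)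
  extend∈[0,1] (suc i) with i ℕ.<? n ∸ 1
  ... | yes i<n-1 = a∈[0,1] (fromℕ< i<n-1)
  ... | no  _     = constant-≤ ℚ.≤-refl , constant-≤ (ℚ.nonNegative⁻¹ 1ℚ)

-- With i = 2j the hypotheses give j < m, hence j + 1 ≤ m. This gap is what keeps x - y from jumping
-- over 2d.
even-<⇒+2≤ : ∀ {i} m → + 2 ℤ.∣ i → i ℤ.≤ + (2 ℕ.* m) → i ≢ + (2 ℕ.* m) →
             i ℤ.+ + 2 ℤ.≤ + (2 ℕ.* m)
even-<⇒+2≤ {i} m 2∣i i≤2m i≢2m with Signed.∣ᵤ⇒∣ {+ 2} {i} 2∣i
... | Signed.divides j refl = begin
  j ℤ.* + 2 ℤ.+ + 2  ≡⟨ ℤ.+-comm (j ℤ.* + 2) (+ 2) ⟩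
  + 2 ℤ.+ j ℤ.* + 2  ≡⟨ ℤ.suc-* j (+ 2) ⟨
  ℤ.suc j ℤ.* + 2    ≤⟨ ℤ.*-monoʳ-≤-nonNeg (+ 2) (ℤ.i<j⇒suc[i]≤j j<m) ⟩
  + m ℤ.* + 2        ≡⟨ 2m≡m*2 ⟨
  + (2 ℕ.* m)        ∎
  where
  open ℤ.≤-Reasoning
  2m≡m*2 : + (2 ℕ.* m) ≡ + m ℤ.* + 2
  2m≡m*2 = trans (ℤ.pos-* 2 m) (ℤ.*-comm (+ 2) (+ m))
  j<m : j ℤ.< + m
  j<m = ℤ.*-cancelʳ-<-nonNeg (+ 2) (subst (j ℤ.* + 2 ℤ.<_) 2m≡m*2 (ℤ.≤∧≢⇒< i≤2m i≢2m))

InRange : ℕ → ℤ → Set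
InRange n x = (ℤ.- + n ℤ.≤ x) × (x ℤ.≤ + n)

-- The difference x - y changes by e - f, which is even and at most 2, while a non-absorbing state
-- leaves room for 2.
IsState-move : ∀ {d n x y} e f → IsState d n (x , y) → x ℤ.- y ≢ + (2 ℕ.* d) →
  e ℤ.- f ℤ.≤ + 2 → + 2 ℤ.∣ e ℤ.- f → InRange n (x ℤ.+ e) → InRange n (y ℤ.+ f) →
  IsState d n (x ℤ.+ e , y ℤ.+ f)
IsState-move {d} {n} {x} {y} e f (_ , _ , x-y≤2d , 2∣x-y) x-y≢2d e-f≤2 2∣e-f x+e∈ y+f∈ =
  x+e∈ , y+f∈
  , (begin
      (x ℤ.+ e) ℤ.- (y ℤ.+ f)    ≡⟨ regroup ⟩
      (x ℤ.- y) ℤ.+ (e ℤ.- f)    ≤⟨ ℤ.+-monoʳ-≤ (x ℤ.- y) e-f≤2 ⟩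
      (x ℤ.- y) ℤ.+ + 2          ≤⟨ even-<⇒+2≤ d 2∣x-y x-y≤2d x-y≢2d ⟩
      + (2 ℕ.* d)                ∎)
  , subst (+ 2 ℤ.∣_) (sym regroup)
      (Signed.∣⇒∣ᵤ (Signed.∣m∣n⇒∣m+n
        (Signed.∣ᵤ⇒∣ {+ 2} {x ℤ.- y} 2∣x-y) (Signed.∣ᵤ⇒∣ {+ 2} {e ℤ.- f} 2∣e-f)))
  where
  open ℤ.≤-Reasoning
  +-interchange-- : ∀ x y e f → (x ℤ.+ e) ℤ.- (y ℤ.+ f) ≡ (x ℤ.- y) ℤ.+ (e ℤ.- f)
  +-interchange-- = ℤ-Ring.solve-∀
  regroup : (x ℤ.+ e) ℤ.- (y ℤ.+ f) ≡ (x ℤ.- y) ℤ.+ (e ℤ.- f)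
  regroup = +-interchange-- x y e f

-- Coupling of the truncated chain with the free walks

module Comparison (d n : ℕ) (1≤n : 1 ℕ.≤ n) (a : Fin (n ∸ 1) → ℝ) (k : ℕ) where

  open Expectation k
  open ≡-Reasoning

  b : ℤ → ℝ
  b = signed (extend n a)

  freeStep : ℤ × ℤ → Dist (ℤ × ℤ)
  freeStep = independent (walk b) (walk b)

  -- At the edge x = n the mass is the padding value `0ℝ`, which vanishes at every index; elsewhere
  -- there is room for a step.
  up-inRange : ∀ {x} → InRange n x → seq (b x) k ≡ 0ℚ ⊎ InRange n (x ℤ.+ + 1)
  up-inRange {x} (-n≤x , x≤n) with x ℤ.≟ + n
  ... | yes refl = inj₁ (cong (λ r → seq r k) (extend-boundary 1≤n a))
  ... | no  x≢n  = inj₂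
    ( ℤ.≤-trans -n≤x (ℤ.i≤i+j x (+ 1))
    , subst (ℤ._≤ + n) (ℤ.+-comm (+ 1) x) (ℤ.i<j⇒suc[i]≤j (ℤ.≤∧≢⇒< x≤n x≢n)))

  -- Quantified over its own `n`, so that splitting it lets `signed` compute at -n: there b is 1 -
  -- 0, and 1 - b is zero.
  b-lower : ∀ {n a} → 1 ℕ.≤ n → seq (1ℝ - signed (extend n a) (ℤ.- + n)) k ≡ 0ℚ
  b-lower {n = suc m} {a} 1≤n rewrite extend-boundary 1≤n a = refl

  down-inRange : ∀ {x} → InRange n x → seq (1ℝ - b x) k ≡ 0ℚ ⊎ InRange n (x ℤ.- + 1)
  down-inRange {x} (-n≤x , x≤n) with ℤ.- + n ℤ.≟ x
  ... | yes refl = inj₁ (b-lower 1≤n)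
  ... | no  -n≢x = inj₂
    ( subst (ℤ.- + n ℤ.≤_) (ℤ.+-comm -[1+ 0 ] x) (ℤ.i<j⇒i≤pred[j] (ℤ.≤∧≢⇒< -n≤x -n≢x))
    , ℤ.≤-trans (ℤ.i-j≤i x (+ 1)) x≤n)

  -- Atom by atom: a kept move contributes the same on both sides, and a discarded one has mass 0 in
  -- the free step as well.
  E-truncatedStep : ∀ {f : State d n → ℚ} {g : ℤ × ℤ → ℚ} → (∀ s → f s ≡ g (proj₁ s)) →
    ∀ s → ¬ Absorbing d n s → E f (truncatedStep d n a s) ≡ E g (freeStep (proj₁ s))
  E-truncatedStep {f} {g} f≗g s@((x , y) , h@(x∈ , y∈ , _)) s∉ =
    E-if-no (absorbing? d n s) f s∉
      -- The four atoms in the order of `walk b x ⊗ walk b y`; their differences e - e′ are 0, 2, -2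
      -- and 0.
      (atom (+ 1) (+ 1) (joint (ℤ.+≤+ ℕ.z≤n) (2 ℕ.∣0) (up-inRange x∈) (up-inRange y∈))
      (atom (+ 1) -[1+ 0 ] (joint ℤ.≤-refl ℕ.∣-refl (up-inRange x∈) (down-inRange y∈))
      (atom -[1+ 0 ] (+ 1) (joint ℤ.-≤+ ℕ.∣-refl (down-inRange x∈) (up-inRange y∈))
      (atom -[1+ 0 ] -[1+ 0 ] (joint (ℤ.+≤+ ℕ.z≤n) (2 ℕ.∣0) (down-inRange x∈) (down-inRange y∈))
      refl))))
    where
    toState-atom : ∀ p z → seq p k ≡ 0ℚ ⊎ IsState d n z →
      maybe′ (λ (q , t) → seq q k ℚ.* f t) 0ℚ (Maybe.map (p ,_) (toState d n z)) ≡
      seq p k ℚ.* g z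
    toState-atom p z p≡0⊎z∈ with isState? d n z
    ... | yes z∈ = cong (seq p k ℚ.*_) (f≗g (z , z∈))
    ... | no  z∉ with p≡0⊎z∈
    ...   | inj₁ p≡0 = sym (trans (cong (ℚ._* g z) p≡0) (ℚ.*-zeroˡ (g z)))
    ...   | inj₂ z∈  = contradiction z∈ z∉

    joint : ∀ {p q e e′} → e ℤ.- e′ ℤ.≤ + 2 → + 2 ℤ.∣ e ℤ.- e′ →
      p ≡ 0ℚ ⊎ InRange n (x ℤ.+ e) → q ≡ 0ℚ ⊎ InRange n (y ℤ.+ e′) →
      p ℚ.* q ≡ 0ℚ ⊎ IsState d n (x ℤ.+ e , y ℤ.+ e′)
    joint {q = q} _ _ (inj₁ p≡0) _ = inj₁ (trans (cong (ℚ._* q) p≡0) (ℚ.*-zeroˡ q))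
    joint {p = p} _ _ (inj₂ _) (inj₁ q≡0) = inj₁ (trans (cong (p ℚ.*_) q≡0) (ℚ.*-zeroʳ p))
    joint {e = e} {e′} e-e′≤2 2∣e-e′ (inj₂ x+e∈) (inj₂ y+e′∈) =
      inj₂ (IsState-move {d} e e′ h s∉ e-e′≤2 2∣e-e′ x+e∈ y+e′∈)

    -- The mass p is left to unification: comparing two real products would
    -- make Agda compare their Cauchy proofs.
    atom : ∀ {p} e e′ → seq p k ≡ 0ℚ ⊎ IsState d n (x ℤ.+ e , y ℤ.+ e′) →
      ∀ {μ v} → E f μ ≡ v →
      E f (maybe′ _∷_ id (Maybe.map (p ,_) (toState d n (x ℤ.+ e , y ℤ.+ e′))) μ) ≡
      seq p k ℚ.* g (x ℤ.+ e , y ℤ.+ e′) ℚ.+ v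
    atom {p} e e′ p≡0⊎z∈ =
      E-maybe-∷ f (Maybe.map (p ,_) (toState d n (x ℤ.+ e , y ℤ.+ e′)))
        (toState-atom p (x ℤ.+ e , y ℤ.+ e′) p≡0⊎z∈)

  freeStep-normalised : ∀ z → Normalised (freeStep z)
  freeStep-normalised (x , y) =
    ⊗-normalised (walk b x) (walk b y) (walk-normalised b x) (walk-normalised b y)

  -- Away from absorption this is inherited from the free step, through `E-truncatedStep` for the
  -- constant 1.
  truncatedStep-normalised : ∀ s → Normalised (truncatedStep d n a s)
  truncatedStep-normalised s = case absorbing? d n s of λ where
    (yes s∈) → E-if-yes (absorbing? d n s) (λ _ → 1ℚ) s∈ refl
    (no  s∉) → trans (E-truncatedStep (λ _ → refl) s s∉) (freeStep-normalised (proj₁ s))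

  absorbing⇒met : ∀ s → Absorbing d n s → Met d (proj₁ s)
  absorbing⇒met ((x , y) , _) x-y≡2d =
    trans (split x y) (cong (λ i → y ℤ.+ i) x-y≡2d)
    where
    split : ∀ i j → i ≡ j ℤ.+ (i ℤ.- j)
    split = ℤ-Ring.solve-∀

  met⇒absorbing : ∀ s → Met d (proj₁ s) → Absorbing d n s
  met⇒absorbing ((x , y) , _) refl = cancel y (+ (2 ℕ.* d))
    where
    cancel : ∀ i j → (i ℤ.+ j) ℤ.- i ≡ j
    cancel = ℤ-Ring.solve-∀

  truncatedHit : ℕ → State d n → ℚ
  truncatedHit N s = E (hitℚ (absorbing? d n)) (trajectory (truncatedStep d n a) s N)

  freeHit : ℕ → ℤ × ℤ → ℚ
  freeHit N z = E (hitℚ (met? d)) (trajectory freeStep z N)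

  -- Induction on `N` over all states at once: both sides are 0 at absorption; elsewhere one step is
  -- taken and `E-truncatedStep` transports the induction hypothesis.
  truncatedHit≡freeHit : ∀ N s → truncatedHit N s ≡ freeHit N (proj₁ s)
  truncatedHit≡freeHit zero    s = refl
  truncatedHit≡freeHit (suc N) s = case absorbing? d n s of λ where
    (yes s∈) → trans
      (E-hit-yes (absorbing? d n) (truncatedStep d n a) s (suc N) s∈)
      (sym (E-hit-yes (met? d) freeStep (proj₁ s) (suc N) (absorbing⇒met s s∈)))
    (no  s∉) → begin
      truncatedHit (suc N) s
        ≡⟨ E-hit-no (absorbing? d n) (truncatedStep d n a) truncatedStep-normalised s N s∉ ⟩
      E (λ t → 1ℚ ℚ.+ truncatedHit N t) (truncatedStep d n a s)
        ≡⟨ E-truncatedStep {g = λ z → 1ℚ ℚ.+ freeHit N z}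
             (λ t → cong (1ℚ ℚ.+_) (truncatedHit≡freeHit N t)) s s∉ ⟩
      E (λ z → 1ℚ ℚ.+ freeHit N z) (freeStep (proj₁ s))
        ≡⟨ E-hit-no (met? d) freeStep freeStep-normalised (proj₁ s) N (s∉ ∘ met⇒absorbing s) ⟨
      freeHit (suc N) (proj₁ s) ∎

  -- b′ is propositionally b so that a definitionally equal but differently
  -- written b′ can be used without comparing the Cauchy proofs in the walks.
  rendezvous≡truncated : ∀ b′ → b′ ≡ b → ∀ N →
    E (λ (xs , ys) → hitℚ (met? d) (Vec.zip xs ys))
      (trajectory (walk b′) (+ 0) N ⊗ trajectory (walk b′) (+ 0) N) ≡
    truncatedHit N (S₀₀ d n)
  rendezvous≡truncated _ refl N = trans
    (E-trajectory-⊗ (walk b) (walk b) (+ 0) (+ 0) N (hitℚ (met? d)))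
    (sym (truncatedHit≡freeHit N (S₀₀ d n)))

lemma3 : ∀ (d n : ℕ) → 1 ℕ.≤ d → d ℕ.≤ n →
    (a : Fin (n ∸ 1) → ℝ) → (∀ i → a i ∈[0,1]) →
    R d ≤∞ U d n a
lemma3 d n 1≤d d≤n a a∈[0,1] q (p , p<q , U≤p) =
  -- One strategy suffices to bound an infimum; the rational p < q that bounds every truncated
  -- expectation serves again.
  extend-strategy n a a∈[0,1] , p , p<q , λ N ε 0<ε →
    let M , bound = U≤p N ε 0<ε in
    -- The threshold `M` carries over, as the two expectations coincide at each index `k`.
    M , λ k M≤k →
      let open Expectation k
          -- 1 ≤ d ≤ n makes n positive, so a_n is a padding zero and not the initial 1/2.
          open Comparison d n (ℕ.≤-trans 1≤d d≤n) a k
          b′   = signed (prob (extend-strategy n a a∈[0,1]))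
          path = trajectory (walk b′) (+ 0) N
      in ℚ.≤-trans
        (ℚ.≤-reflexive (trans
          (seq-foldr _ (λ (xs , ys) → hitℚ (met? d) (Vec.zip xs ys)) (λ _ _ _ → refl)
            (path ⊗ path))
          (trans (rendezvous≡truncated b′ refl N)
            (sym (seq-foldr _ (hitℚ (absorbing? d n)) (λ _ _ _ → refl)
              (trajectory (truncatedStep d n a) (S₀₀ d n) N))))))
        (bound k M≤k)
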